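{- Let $C_{(<,\neq)}(x,y)$ be the bivariate generating function of the Catalan words avoiding the ordered pair of relations $(<,\neq)$, where $x$ marks the length and $y$ marks the number of descents. Then $$C_{(<,\neq)}(x,y)=\frac {1 - 2 x^2 - x^3 + 2 x^2 y-(1+x)\sqrt {1 - 2 x - x^2 + 2 x^3 + x^4 - 4 x^3 y}}{2x^{2}y}.$$
   Context: A Catalan word of length $n$ is a word $w=w_1w_2\cdots w_n$ over the non-negative integers with $w_1=0$ and $0\leq w_i\leq w_{i-1}+1$ for $i=2,\dots,n$; the empty word is the unique Catalan word of length $0$. For relations $X,Y\in\{<,>,\leq,\geq,=,\neq\}$, a word $w$ contains the pattern $(X,Y)$ if there is an index $i\geq 1$ (with $i+2\le n$) such that $w_i\,X\,w_{i+1}$ and $w_{i+1}\,Y\,w_{i+2}$; otherwise $w$ avoids $(X,Y)$. The number of descents $\mathrm{des}(w)$ is the number of indices $i$ with $w_i>w_{i+1}$. The bivariate generating function is $C_{(X,Y)}(x,y)=\sum_{w}x^{|w|}y^{\mathrm{des}(w)}$, the sum being over all Catalan words $w$ (of any length $|w|\geq 0$) avoiding $(X,Y)$. Identities are between formal power series in $x$ with coefficients polynomials in $y$ (after clearing denominators); the square root of a power series with constant term $1$ is the one with constant term $1$. -}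

module Defs where

open import Level using (Level; 0ℓ)
open import Algebra.Bundles using (RawRing)
import Algebra.Definitions.RawSemiring as RawSemiringDefs
open import Data.Fin.Base using (toℕ)
open import Data.Bool.Base using (if_then_else_)
import Data.Integer.Base as ℤ
open ℤ using (ℤ)
open import Data.List.Base using (List; []; _∷_; map; concatMap; filter; foldr; upTo; length)
open import Data.List.Membership.Propositional using (_∈_; find)
open import Data.List.Membership.Propositional.Properties
  using (∈-map⁺; ∈-map⁻; ∈-concatMap⁺; ∈-concatMap⁻; ∈-upTo⁺; ∈-upTo⁻)
open import Data.List.Properties using (∷-injectiveˡ; ∷-injectiveʳ)
open import Data.List.Relation.Unary.All as All using ()
open import Data.List.Relation.Unary.AllPairs as AllPairs using ()
import Data.List.Relation.Unary.AllPairs.Properties as AllPairs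
import Data.List.Relation.Unary.All.Properties as All
open import Data.List.Relation.Unary.Any as Any using (here)
open import Data.List.Relation.Unary.Linked using (Linked; []; [-]; _∷_)
open import Data.List.Relation.Unary.Unique.Propositional using (Unique; []; _∷_)
import Data.List.Relation.Unary.Unique.Propositional.Properties as Unique
open import Data.Nat.Base as ℕ using (ℕ; zero; suc; _∸_; _≤_; s≤s)
open import Data.Nat.Properties using (_≟_; _<?_; suc-injective; ≤-pred)
open import Data.Product.Base using (_×_; _,_)
open import Data.Unit.Base using (⊤; tt)
open import Function.Bundles using (_⇔_; mk⇔)
open import Relation.Binary.Core using (Rel)
open import Relation.Binary.Definitions using (Decidable)
open import Relation.Binary.PropositionalEquality using (_≡_; _≢_; refl; sym; trans; cong)
open import Relation.Nullary.Decidable using (Dec; yes; no; does; ¬?)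
open import Relation.Nullary.Negation using (¬_)

Word : Set
Word = List ℕ

IsCatalan : Word → Set
IsCatalan []      = ⊤
IsCatalan (a ∷ w) = a ≡ 0 × Linked (λ b c → c ≤ suc b) (a ∷ w)

data Contains (X Y : Rel ℕ 0ℓ) : Word → Set where
  here  : ∀ {a b c w} → X a b → Y b c → Contains X Y (a ∷ b ∷ c ∷ w)
  there : ∀ {a w} → Contains X Y w → Contains X Y (a ∷ w)

Avoids : (X Y : Rel ℕ 0ℓ) → Word → Set
Avoids X Y w = ¬ Contains X Y w

des : Word → ℕ
des []          = 0
des (_ ∷ [])    = 0
des (a ∷ b ∷ w) = (if does (b <? a) then 1 else 0) ℕ.+ des (b ∷ w)

module _ {X Y : Rel ℕ 0ℓ} (X? : Decidable X) (Y? : Decidable Y) where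

  contains? : (w : Word) → Dec (Contains X Y w)
  contains? []       = no λ ()
  contains? (a ∷ []) = no λ { (there ()) }
  contains? (a ∷ b ∷ []) = no λ { (there (there ())) }
  contains? (a ∷ b ∷ c ∷ w) with X? a b | Y? b c | contains? (b ∷ c ∷ w)
  ... | _      | _      | yes p = yes (there p)
  ... | yes x  | yes y  | no _  = yes (here x y)
  ... | no ¬x  | _      | no ¬p = no λ { (here x _) → ¬x x ; (there p) → ¬p p }
  ... | yes _  | no ¬y  | no ¬p = no λ { (here _ y) → ¬y y ; (there p) → ¬p p }

  avoids? : (w : Word) → Dec (Avoids X Y w)
  avoids? w = ¬? (contains? w)

infix 4 _≢?_
_≢?_ : Decidable {A = ℕ} _≢_
m ≢? n = ¬? (m ≟ n)

-- The words v of length n that can follow a letter a in a Catalan word.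
continuations : ℕ → ℕ → List Word
continuations a zero    = [] ∷ []
continuations a (suc n) =
  concatMap (λ b → map (b ∷_) (continuations b n)) (upTo (suc (suc a)))

-- Lists every Catalan word of length n exactly once: see ∈-catalanWords and
-- catalanWords-unique.
catalanWords : ℕ → List Word
catalanWords zero    = [] ∷ []
catalanWords (suc n) = map (0 ∷_) (continuations 0 n)

private

  Linked′ : Word → Set
  Linked′ = Linked (λ b c → c ≤ suc b)

  continuations-sound : ∀ a n {v} → v ∈ continuations a n →
                        Linked′ (a ∷ v) × length v ≡ n
  continuations-sound a zero (here refl) = [-] , refl
  continuations-sound a (suc n) v∈
    with b , b∈ , v∈′ ← find (∈-concatMap⁻ (λ b → map (b ∷_) (continuations b n)) {xs = upTo (suc (suc a))} v∈)
    with u , u∈ , refl ← ∈-map⁻ (b ∷_) v∈′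
    with l , e ← continuations-sound b n u∈
    = ≤-pred (∈-upTo⁻ b∈) ∷ l , cong suc e

  continuations-complete : ∀ a n {v} → Linked′ (a ∷ v) → length v ≡ n →
                           v ∈ continuations a n
  continuations-complete a zero    {[]}    _       _ = here refl
  continuations-complete a (suc n) {b ∷ v} (r ∷ l) e =
    ∈-concatMap⁺ (λ b → map (b ∷_) (continuations b n))
      (Any.map (λ { refl → ∈-map⁺ (b ∷_) (continuations-complete b n l (suc-injective e)) })
               (∈-upTo⁺ (s≤s r)))

  continuations-unique : ∀ a n → Unique (continuations a n)
  continuations-unique a zero    = All.[] ∷ []
  continuations-unique a (suc n) = Unique.concat⁺
    (All.map⁺ (All.universal (λ b → Unique.map⁺ ∷-injectiveʳ (continuations-unique b n)) _))
    (AllPairs.map⁺ (AllPairs.map disjoint (Unique.upTo⁺ (suc (suc a)))))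
    where
    disjoint : ∀ {b c} → b ≢ c → ∀ {v} →
               ¬ (v ∈ map (b ∷_) (continuations b n) × v ∈ map (c ∷_) (continuations c n))
    disjoint b≢c (p , q) with ∈-map⁻ _ p | ∈-map⁻ _ q
    ... | _ , _ , e | _ , _ , e′ = b≢c (∷-injectiveˡ (trans (sym e) e′))

∈-catalanWords : ∀ n w → w ∈ catalanWords n ⇔ (IsCatalan w × length w ≡ n)
∈-catalanWords n w = mk⇔ (sound n) (complete n w)
  where
  sound : ∀ n {w} → w ∈ catalanWords n → IsCatalan w × length w ≡ n
  sound zero    (here refl) = tt , refl
  sound (suc n) w∈ with _ , v∈ , refl ← ∈-map⁻ (0 ∷_) w∈ =
    let l , e = continuations-sound 0 n v∈ in (refl , l) , cong suc e

  complete : ∀ n w → IsCatalan w × length w ≡ n → w ∈ catalanWords n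
  complete zero    []      _                = here refl
  complete (suc n) (_ ∷ v) ((refl , l) , e) =
    ∈-map⁺ (0 ∷_) (continuations-complete 0 n l (suc-injective e))

catalanWords-unique : ∀ n → Unique (catalanWords n)
catalanWords-unique zero    = All.[] ∷ []
catalanWords-unique (suc n) = Unique.map⁺ ∷-injectiveʳ (continuations-unique 0 n)

-- Polynomials over ℤ, as coefficient lists in increasing degree.  Trailing
-- zeros are allowed, so equality compares coefficients.

module Polynomial where

  Poly : Set
  Poly = List ℤ

  coeff : Poly → ℕ → ℤ
  coeff []      _       = ℤ.0ℤ
  coeff (a ∷ p) zero    = a
  coeff (a ∷ p) (suc k) = coeff p k

  infix  8 -_
  infixl 7 _*_
  infixl 6 _+_
  infix  4 _≈_

  _≈_ : Rel Poly 0ℓ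
  p ≈ q = ∀ k → coeff p k ≡ coeff q k

  _+_ : Poly → Poly → Poly
  []      + q       = q
  (a ∷ p) + []      = a ∷ p
  (a ∷ p) + (b ∷ q) = (a ℤ.+ b) ∷ (p + q)

  _*_ : Poly → Poly → Poly
  []      * q = []
  (a ∷ p) * q = map (a ℤ.*_) q + (ℤ.0ℤ ∷ (p * q))

  -_ : Poly → Poly
  -_ = map (ℤ.-_)

  indeterminate : Poly
  indeterminate = ℤ.0ℤ ∷ ℤ.1ℤ ∷ []

ℤ[y] : RawRing 0ℓ 0ℓ
ℤ[y] = record
  { Carrier = Poly
  ; _≈_     = _≈_
  ; _+_     = _+_
  ; _*_     = _*_
  ; -_      = -_
  ; 0#      = []
  ; 1#      = ℤ.1ℤ ∷ []
  }
  where open Polynomial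

-- Formal power series in one indeterminate, f standing for Σₙ f(n) xⁿ

module PowerSeries {c ℓ : Level} (R : RawRing c ℓ) where

  open RawRing R
  open RawSemiringDefs rawSemiring using (sum)

  Series : Set c
  Series = ℕ → Carrier

  constant : Carrier → Series
  constant a zero    = a
  constant a (suc _) = 0#

  indeterminate : Series
  indeterminate zero          = 0#
  indeterminate (suc zero)    = 1#
  indeterminate (suc (suc _)) = 0#

  rawRing : RawRing c ℓ
  rawRing = record
    { Carrier = Series
    ; _≈_     = λ f g → ∀ n → f n ≈ g n
    ; _+_     = λ f g n → f n + g n
    ; _*_     = λ f g n → sum {suc n} (λ i → f (toℕ i) * g (n ∸ toℕ i))
    ; -_      = λ f n → - f n
    ; 0#      = λ _ → 0#
    ; 1#      = constant 1#
    }

  -- For f with constant term 1: s is the square root of f whose constant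
  -- term is 1.
  IsSqrt : Series → Series → Set ℓ
  IsSqrt f s = (s 0 ≈ 1#) × (∀ n → RawRing._*_ rawRing s s n ≈ f n)

ℤ[y]⟦x⟧ : RawRing 0ℓ 0ℓ
ℤ[y]⟦x⟧ = PowerSeries.rawRing ℤ[y]

module BivariateSeries where

  open PowerSeries ℤ[y] public using (Series; IsSqrt)
  open RawRing ℤ[y]⟦x⟧ public using (_≈_; _+_; _*_; -_; 1#)
  -- n · f is the n-fold sum f + ⋯ + f and binds like _^_, so 2 · x ^ 2 * y
  -- is (2 · (x ^ 2)) * y.
  open RawSemiringDefs (RawRing.rawSemiring ℤ[y]⟦x⟧) public
    using (_^_) renaming (_×_ to _·_)

  infixl 6 _-_
  _-_ : Series → Series → Series
  f - g = f + (- g)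

  x y : Series
  x = PowerSeries.indeterminate ℤ[y]
  y = PowerSeries.constant ℤ[y] Polynomial.indeterminate

-- The coefficient of xⁿ is the polynomial Σ y^des(w), w ranging over the
-- Catalan words of length n that avoid (X , Y).
C : {X Y : Rel ℕ 0ℓ} → Decidable X → Decidable Y → BivariateSeries.Series
C X? Y? n =
  foldr P._+_ P.0# (map (λ w → Polynomial.indeterminate ^ des w)
                        (filter (avoids? X? Y?) (catalanWords n)))
  where
  module P = RawRing ℤ[y]
  open RawSemiringDefs P.rawSemiring using (_^_)

{-# OPTIONS --safe #-}
module Submission where

-- After an ascent a, a+1 an avoiding word must stop or repeat the letter a+1.
-- Hence the series G_a = Σ x^|v| y^des(av), summed over the v for which av is
-- an avoiding word with the successor condition w_{i+1} ≤ w_i + 1, satisfy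
--   G_a = 1 + x + x (y Σ_{b<a} G_b + G_a + x G_{a+1}),
-- and these equations determine them coefficient by coefficient.  Differences
-- of consecutive equations form a linear recurrence with a power series root
-- λ = 1 + xyu, where u = 1 + xu + x²u + x³yu², so that G_a = (1+x) u λ^a
-- and C = 1 + x G_0 = 1 + x(1+x)u.  Solving the quadratic equation for u
-- gives √D = 1 − x − x² − 2x³yu; it is the only square root of D with constant
-- term 1 because ℤ[y] has no 2-torsion.

open import Defs
open import Algebra.Bundles using (RawRing; CommutativeRing)
import Algebra.Construct.Pointwise as Pointwise
import Algebra.Definitions.RawSemiring as RawSemiringDefs
import Algebra.Morphism.RingMonomorphism as RingMonomorphism
import Algebra.Solver.Ring.NaturalCoefficients.Default as RingSolver
open import Algebra.Structures using (IsCommutativeRing)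
open import Data.Bool.Base using (true; false; if_then_else_)
import Data.Integer.Base as ℤ
import Data.Integer.Properties as ℤ
open import Data.List.Base using (List; []; _∷_; _++_; [_]; map; concatMap; filter; foldr; upTo)
open import Data.List.Properties using (upTo-∷ʳ; concatMap-++; ++-identityʳ; map-concatMap; map-∘)
open import Data.Nat.Base as ℕ using (ℕ; zero; suc; z≤n; s≤s)
open import Data.Nat.Properties using (_<?_)
import Data.Nat.Properties as ℕ
open import Data.Product using (∃-syntax; _×_; _,_)
open import Function.Base using (_∘_)
open import Function.Bundles using (_⇔_; mk⇔)
open import Level using (Level; 0ℓ)
open import Relation.Binary.PropositionalEquality as ≡ using (_≡_; _≢_)
import Relation.Binary.Reasoning.Setoid as SetoidReasoning
open import Relation.Nullary.Decidable using (does; does-⇔; dec-true; dec-false)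
open import Relation.Nullary.Negation using (contradiction)
open import Relation.Unary using () renaming (Decidable to Decidable₁)

private
  variable
    c ℓ : Level

-- Finite sums.

module FiniteSum (R : RawRing c ℓ) where

  open RawRing R

  -- Splitting off the top index makes a sum over the letters b ≤ a + 1 expose the letters a and a +
  -- 1 by computation.
  ∑ : (ℕ → Carrier) → ℕ → Carrier
  ∑ f zero    = 0#
  ∑ f (suc n) = ∑ f n + f n

-- The quadratic equation for u and the closed form, in any commutative ring.

module RingProperties (R : CommutativeRing c ℓ) where

  open CommutativeRing R
  open import Algebra.Properties.Group +-group using (x≈y⇒x∙y⁻¹≈ε) renaming (∙-cancelʳ to +-cancelʳ)
  open import Algebra.Properties.Ring ring using ([y-z]x≈yx-zx)
  open RingSolver commutativeSemiring
  open SetoidReasoning setoid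

  [a-b]+b≈a : ∀ a b → (a - b) + b ≈ a
  [a-b]+b≈a a b = begin
    (a - b) + b    ≈⟨ +-assoc a (- b) b ⟩
    a + (- b + b)  ≈⟨ +-congˡ (-‿inverseˡ b) ⟩
    a + 0#         ≈⟨ +-identityʳ a ⟩
    a              ∎

  a+b≈c⇒a≈c-b : ∀ {a b c} → a + b ≈ c → a ≈ c - b
  a+b≈c⇒a≈c-b {a} {b} {c} a+b≈c = +-cancelʳ b a (c - b) (trans a+b≈c (sym ([a-b]+b≈a c b)))

  difference-of-squares : ∀ {a b} → a * a ≈ b * b → (a - b) * (a + b) ≈ 0#
  difference-of-squares {a} {b} a²≈b² = begin
    (a - b) * (a + b)          ≈⟨ [y-z]x≈yx-zx (a + b) a b ⟩
    a * (a + b) - b * (a + b)  ≈⟨ x≈y⇒x∙y⁻¹≈ε equal ⟩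
    0#                         ∎
    where
    equal : a * (a + b) ≈ b * (a + b)
    equal = begin
      a * (a + b)    ≈⟨ solve 2 (λ a b → a :* (a :+ b) := a :* a :+ a :* b) refl a b ⟩
      a * a + a * b  ≈⟨ +-congʳ a²≈b² ⟩
      b * b + a * b  ≈⟨ solve 2 (λ a b → b :* b :+ a :* b := b :* (a :+ b)) refl a b ⟩
      b * (a + b)    ∎

  module ClosedForm (x y u : Carrier) (u-root : u ≈ 1# + x * (u + x * (u + x * (y * (u * u))))) where

    open RawSemiringDefs (RawRing.rawSemiring rawRing) using (_^_) renaming (_×_ to _·_)
    open FiniteSum rawRing using (∑)

    -- `D` is the discriminant (1 - x - x²)² - 4x³y of the quadratic x³y u² - (1 - x - x²) u + 1 =
    -- 0. `Q` gathers all that is subtracted from 1 in its square root, so that a semiring solver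
    -- can treat `√D` as an atom with √D + Q = 1.
    D Q √D : Carrier
    D = 1# - 2 · x - x ^ 2 + 2 · x ^ 3 + x ^ 4 - 4 · x ^ 3 * y
    Q = x + x ^ 2 + 2 · x ^ 3 * y * u
    √D = 1# - Q

    √D+Q≈1 : √D + Q ≈ 1#
    √D+Q≈1 = [a-b]+b≈a 1# Q

    private
      -- These mirror how `2 ·_` and `4 ·_` unfold, so that solved identities match the goals by
      -- computation.
      :two :four : ∀ {n} → Polynomial n → Polynomial n
      :two p = p :+ (p :+ con 0)
      :four p = p :+ (p :+ :two p)

      :Q : ∀ {n} → Polynomial n → Polynomial n → Polynomial n → Polynomial n
      :Q x y u = x :+ x :^ 2 :+ :two (x :^ 3) :* y :* u

      -- D = D⁺ − D⁻; the solver works in semirings, so D⁻ is moved to the other side.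
      D⁺ D⁻ : Carrier
      D⁺ = 1# + 2 · x ^ 3 + x ^ 4
      D⁻ = 2 · x + x ^ 2 + 4 · x ^ 3 * y

      D+D⁻≈D⁺ : D + D⁻ ≈ D⁺
      D+D⁻≈D⁺ = begin
        D + D⁻
          ≈⟨ solve 8 (λ a b c a′ b′ c′ p q →
                       con 1 :+ a′ :+ b′ :+ p :+ q :+ c′ :+ (a :+ b :+ c)
                    := con 1 :+ p :+ q :+ (a′ :+ a) :+ (b′ :+ b) :+ (c′ :+ c))
               refl a b d (- a) (- b) (- d) (2 · x ^ 3) (x ^ 4) ⟩
        D⁺ + (- a + a) + (- b + b) + (- d + d)
          ≈⟨ +-cong (+-cong (+-congˡ (-‿inverseˡ a)) (-‿inverseˡ b)) (-‿inverseˡ d) ⟩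
        D⁺ + 0# + 0# + 0#
          ≈⟨ trans (+-identityʳ _) (trans (+-identityʳ _) (+-identityʳ _)) ⟩
        D⁺ ∎
        where
        a = 2 · x
        b = x ^ 2
        d = 4 · x ^ 3 * y

    √D²≈D : √D * √D ≈ D
    √D²≈D = +-cancelʳ (two Q + D⁻) (√D * √D) D (begin
      √D * √D + (two Q + D⁻)
        -- As √D + Q = 1, the term 2Q equals 2Q(√D + Q), which completes √D² to (√D + Q)² + Q².
        ≈⟨ +-congˡ (+-congʳ (trans (sym (*-identityʳ _)) (*-congˡ (sym √D+Q≈1)))) ⟩
      √D * √D + (two Q * (√D + Q) + D⁻)
        ≈⟨ solve 3 (λ s q d → s :* s :+ (:two q :* (s :+ q) :+ d)
                           := (s :+ q) :* (s :+ q) :+ q :* q :+ d) refl √D Q D⁻ ⟩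
      (√D + Q) * (√D + Q) + Q * Q + D⁻
        ≈⟨ +-congʳ (+-congʳ (*-cong √D+Q≈1 √D+Q≈1)) ⟩
      1# * 1# + Q * Q + D⁻
        -- Together with 4x³y from `D⁻`, the terms of Q² that contain u form 4x³y times the
        -- right-hand side of `u-root`.
        ≈⟨ solve 3 (λ x y u → con 1 :* con 1 :+ :Q x y u :* :Q x y u :+ :D⁻ x y
                := :rest x :+ :four (x :^ 3) :* y :* (con 1 :+ x :* (u :+ x :* (u :+ x :* (y :* (u :* u))))))
              refl x y u ⟩
      rest + 4 · x ^ 3 * y * (1# + x * (u + x * (u + x * (y * (u * u)))))
        ≈⟨ +-congˡ (*-congˡ u-root) ⟨
      rest + 4 · x ^ 3 * y * u
        ≈⟨ solve 3 (λ x y u → :rest x :+ :four (x :^ 3) :* y :* u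
                := con 1 :+ :two (x :^ 3) :+ x :^ 4 :+ :two (:Q x y u)) refl x y u ⟩
      D⁺ + two Q
        ≈⟨ +-congʳ D+D⁻≈D⁺ ⟨
      D + D⁻ + two Q
        ≈⟨ solve 3 (λ d e q → d :+ e :+ q := d :+ (q :+ e)) refl D D⁻ (two Q) ⟩
      D + (two Q + D⁻) ∎)
      where
      two = 2 ·_

      rest : Carrier
      rest = 1# + 2 · x + 2 · x ^ 2 + 2 · x ^ 3 + x ^ 4

      :rest : ∀ {n} → Polynomial n → Polynomial n
      :rest x = con 1 :+ :two x :+ :two (x :^ 2) :+ :two (x :^ 3) :+ x :^ 4

      :D⁻ : ∀ {n} → Polynomial n → Polynomial n → Polynomial n
      :D⁻ x y = :two x :+ x :^ 2 :+ :four (x :^ 3) :* y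

    Q/x : Carrier
    Q/x = 1# + x + 2 · x ^ 2 * y * u

    -- For power series this says that `Q` has no constant term, whence `√D` has constant term 1.
    Q-multiple : Q ≈ x * Q/x
    Q-multiple = solve 3 (λ x y u → :Q x y u := x :* (con 1 :+ x :+ :two (x :^ 2) :* y :* u)) refl x y u

    cleared-formula : ∀ {C S} → C ≈ 1# + x * ((1# + x) * u) → S ≈ √D →
      2 · x ^ 2 * y * C ≈ 1# - 2 · x ^ 2 - x ^ 3 + 2 · x ^ 2 * y - (1# + x) * S
    -- Since (1 + x)Q is `a + b + x` plus 2x²y times x(1 + x)u, adding `a + b + x` produces (1 +
    -- x)(√D + Q) = 1 + x and eliminates u.
    cleared-formula {C} {S} C≈ S≈ = a+b≈c⇒a≈c-b (+-cancelʳ (a + b + x) _ _ (begin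
      p * C + (1# + x) * S + (a + b + x)
        ≈⟨ +-congʳ (+-cong (*-congˡ C≈) (*-congˡ S≈)) ⟩
      p * (1# + x * ((1# + x) * u)) + (1# + x) * √D + (a + b + x)
        ≈⟨ solve 4 (λ x y u s →
            :two (x :^ 2) :* y :* (con 1 :+ x :* ((con 1 :+ x) :* u)) :+ (con 1 :+ x) :* s
               :+ (:two (x :^ 2) :+ x :^ 3 :+ x)
            := :two (x :^ 2) :* y :+ (con 1 :+ x) :* (s :+ :Q x y u)) refl x y u √D ⟩
      p + (1# + x) * (√D + Q)
        ≈⟨ +-congˡ (*-congˡ √D+Q≈1) ⟩
      p + (1# + x) * 1#
        ≈⟨ +-congˡ (trans (*-identityʳ _) (sym (trans (+-identityʳ _) (+-identityʳ _)))) ⟩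
      p + (1# + x + 0# + 0#)
        ≈⟨ +-congˡ (+-cong (+-congˡ (-‿inverseˡ a)) (-‿inverseˡ b)) ⟨
      p + (1# + x + (- a + a) + (- b + b))
        ≈⟨ solve 6 (λ p x a b a′ b′ → p :+ (con 1 :+ x :+ (a′ :+ a) :+ (b′ :+ b))
                                   := con 1 :+ a′ :+ b′ :+ p :+ (a :+ b :+ x))
             refl p x a b (- a) (- b) ⟩
      1# - a - b + p + (a + b + x) ∎))
      where
      a = 2 · x ^ 2
      b = x ^ 3
      p = 2 · x ^ 2 * y

    closedForm : ℕ → Carrier
    closedForm a = (1# + x) * (u * (1# + x * (y * u)) ^ a)

    private
      -- Telescoping: with λ = 1 + xyu, one more factor λ adds xyu (1 + x) λ^a, which is xy times
      -- `closedForm a`.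
      geometric-sum : ∀ a → (1# + x) * (1# + x * (y * u)) ^ a ≈ (1# + x) + x * (y * ∑ closedForm a)
      geometric-sum zero    =
        solve 2 (λ x y → (con 1 :+ x) :* con 1 := (con 1 :+ x) :+ x :* (y :* con 0)) refl x y
      geometric-sum (suc a) = begin
        (1# + x) * ((1# + x * (y * u)) * (1# + x * (y * u)) ^ a)
          ≈⟨ solve 4 (λ x y u l → (con 1 :+ x) :* ((con 1 :+ x :* (y :* u)) :* l)
                   := (con 1 :+ x) :* l :+ x :* (y :* ((con 1 :+ x) :* (u :* l)))) refl x y u _ ⟩
        (1# + x) * (1# + x * (y * u)) ^ a + x * (y * closedForm a)
          ≈⟨ +-congʳ (geometric-sum a) ⟩
        (1# + x) + x * (y * ∑ closedForm a) + x * (y * closedForm a)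
          ≈⟨ solve 4 (λ x y s w → (con 1 :+ x) :+ x :* (y :* s) :+ x :* (y :* w)
                   := (con 1 :+ x) :+ x :* (y :* (s :+ w))) refl x y _ _ ⟩
        (1# + x) + x * (y * ∑ closedForm (suc a)) ∎

    -- In terms of λ = 1 + xyu the equation for u reads u = 1 + xu + x²uλ. Multiplied by (1 + x)
    -- λ^a, its last two terms become the level and ascent terms, and `geometric-sum` unwinds the
    -- first into 1 + x and the descents.
    closedForm-recursion : ∀ a →
      closedForm a ≈ (1# + x) + x * ((y * ∑ closedForm a + closedForm a) + x * closedForm (suc a))
    closedForm-recursion a = begin
      (1# + x) * (u * λᵃ)
        ≈⟨ *-congˡ (*-congʳ u-root) ⟩
      (1# + x) * ((1# + x * (u + x * (u + x * (y * (u * u))))) * λᵃ)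
        ≈⟨ solve 4 (λ x y u l →
                (con 1 :+ x) :* ((con 1 :+ x :* (u :+ x :* (u :+ x :* (y :* (u :* u))))) :* l)
             := (con 1 :+ x) :* l :+ x :* ((con 1 :+ x) :* (u :* l)
                  :+ x :* ((con 1 :+ x) :* (u :* ((con 1 :+ x :* (y :* u)) :* l))))) refl x y u λᵃ ⟩
      (1# + x) * λᵃ + x * (closedForm a + x * closedForm (suc a))
        ≈⟨ +-congʳ (geometric-sum a) ⟩
      (1# + x) + x * (y * ∑ closedForm a) + x * (closedForm a + x * closedForm (suc a))
        ≈⟨ solve 5 (λ x y s w v → (con 1 :+ x) :+ x :* (y :* s) :+ x :* (w :+ x :* v)
                               := (con 1 :+ x) :+ x :* ((y :* s :+ w) :+ x :* v)) refl x y _ _ _ ⟩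
      (1# + x) + x * ((y * ∑ closedForm a + closedForm a) + x * closedForm (suc a)) ∎
      where
      λᵃ = (1# + x * (y * u)) ^ a

-- Formal power series over a commutative ring.

module SeriesProperties (R : CommutativeRing c ℓ) where

  open CommutativeRing R
  open PowerSeries rawRing public using (Series; constant; indeterminate)
  open RawRing (PowerSeries.rawRing rawRing) public using ()
    renaming (_≈_ to _≋_; _+_ to _⊕_; _*_ to _⊛_; -_ to ⊝_; 0# to 𝟘; 1# to 𝟙)
  open import Algebra.Properties.CommutativeSemigroup +-commutativeSemigroup using (interchange)
  open SetoidReasoning setoid

  -- (f ⊛ g) (suc n) reduces to f 0 * g (suc n) + (tail f ⊛ g) n, so identities
  -- between products are proved by induction on n with f generalised to tail f.
  tail : Series → Series
  tail f n = f (suc n)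

  infixr 8 _⊙_
  _⊙_ : Carrier → Series → Series
  (a ⊙ f) n = a * f n

  -- Congruence modulo x^n. It is vacuous at n = 0, which starts the fixed-point iteration.
  infix 4 _≈[_]_
  _≈[_]_ : Series → ℕ → Series → Set ℓ
  f ≈[ n ] g = ∀ m → m ℕ.< n → f m ≈ g m

  -- Coefficient n of a product involves the factors only up to degree n. Contractivity needs this
  -- truncated form of congruence.
  ⊛-cong-≤ : ∀ n {f f′ g g′} → f ≈[ suc n ] f′ → g ≈[ suc n ] g′ →
             (f ⊛ g) n ≈ (f′ ⊛ g′) n
  ⊛-cong-≤ zero    p q = +-congʳ (*-cong (p 0 (s≤s z≤n)) (q 0 (s≤s z≤n)))
  ⊛-cong-≤ (suc n) p q = +-cong (*-cong (p 0 (s≤s z≤n)) (q (suc n) ℕ.≤-refl))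
    (⊛-cong-≤ n (λ m m<n → p (suc m) (s≤s m<n)) (λ m m<n → q m (ℕ.m≤n⇒m≤1+n m<n)))

  ⊛-cong : ∀ {f f′ g g′} → f ≋ f′ → g ≋ g′ → (f ⊛ g) ≋ (f′ ⊛ g′)
  ⊛-cong p q n = ⊛-cong-≤ n (λ m _ → p m) (λ m _ → q m)

  ⊛-zeroˡ : ∀ f → (𝟘 ⊛ f) ≋ 𝟘
  ⊛-zeroˡ f zero    = trans (+-identityʳ _) (zeroˡ _)
  ⊛-zeroˡ f (suc n) = trans (+-cong (zeroˡ _) (⊛-zeroˡ f n)) (+-identityʳ _)

  constant-⊛ : ∀ a f → (constant a ⊛ f) ≋ a ⊙ f
  constant-⊛ a f zero    = +-identityʳ _
  constant-⊛ a f (suc n) = trans (+-congˡ (⊛-zeroˡ f n)) (+-identityʳ _)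

  ⊛-identityˡ : ∀ f → (𝟙 ⊛ f) ≋ f
  ⊛-identityˡ f n = trans (constant-⊛ 1# f n) (*-identityˡ _)

  indeterminate-⊛-zero : ∀ f → (indeterminate ⊛ f) 0 ≈ 0#
  indeterminate-⊛-zero f = trans (+-identityʳ _) (zeroˡ _)

  indeterminate-⊛-suc : ∀ f n → (indeterminate ⊛ f) (suc n) ≈ f n
  indeterminate-⊛-suc f n = begin
    0# * f (suc n) + (tail indeterminate ⊛ f) n ≈⟨ +-cong (zeroˡ _) (⊛-cong {g = f} tail≋𝟙 (λ _ → refl) n) ⟩
    0# + (𝟙 ⊛ f) n                              ≈⟨ +-identityˡ _ ⟩
    (𝟙 ⊛ f) n                                   ≈⟨ ⊛-identityˡ f n ⟩
    f n                                         ∎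
    where
    tail≋𝟙 : tail indeterminate ≋ 𝟙
    tail≋𝟙 zero    = refl
    tail≋𝟙 (suc _) = refl

  ⊛-distribʳ : ∀ h f g → ((f ⊕ g) ⊛ h) ≋ ((f ⊛ h) ⊕ (g ⊛ h))
  ⊛-distribʳ h f g zero = begin
    (f 0 + g 0) * h 0 + 0#                ≈⟨ +-cong (distribʳ _ _ _) (sym (+-identityʳ _)) ⟩
    (f 0 * h 0 + g 0 * h 0) + (0# + 0#)   ≈⟨ interchange _ _ _ _ ⟩
    (f 0 * h 0 + 0#) + (g 0 * h 0 + 0#)   ∎
  ⊛-distribʳ h f g (suc n) =
    trans (+-cong (distribʳ _ _ _) (⊛-distribʳ h (tail f) (tail g) n)) (interchange _ _ _ _)

  ⊙-⊛ : ∀ a f g → ((a ⊙ f) ⊛ g) ≋ a ⊙ (f ⊛ g)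
  ⊙-⊛ a f g zero = begin
    (a * f 0) * g 0 + 0#  ≈⟨ +-identityʳ _ ⟩
    (a * f 0) * g 0       ≈⟨ *-assoc _ _ _ ⟩
    a * (f 0 * g 0)       ≈⟨ *-congˡ (+-identityʳ _) ⟨
    a * (f 0 * g 0 + 0#)  ∎
  ⊙-⊛ a f g (suc n) =
    trans (+-cong (*-assoc _ _ _) (⊙-⊛ a (tail f) g n)) (sym (distribˡ _ _ _))

  -- A product unfolds by definition along its first factor. This is the mirror unfolding along the
  -- second; comparing both gives commutativity.
  ⊛-last : ∀ f g n → (f ⊛ g) (suc n) ≈ (f ⊛ tail g) n + f (suc n) * g 0
  ⊛-last f g zero    = begin
    f 0 * g 1 + (f 1 * g 0 + 0#) ≈⟨ +-congˡ (+-identityʳ _) ⟩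
    f 0 * g 1 + f 1 * g 0        ≈⟨ +-congʳ (+-identityʳ _) ⟨
    (f 0 * g 1 + 0#) + f 1 * g 0 ∎
  ⊛-last f g (suc n) = trans (+-congˡ (⊛-last (tail f) g n)) (sym (+-assoc _ _ _))

  ⊛-comm : ∀ f g → (f ⊛ g) ≋ (g ⊛ f)
  ⊛-comm f g zero    = +-congʳ (*-comm _ _)
  ⊛-comm f g (suc n) = begin
    (f ⊛ g) (suc n)                     ≈⟨ ⊛-last f g n ⟩
    (f ⊛ tail g) n + f (suc n) * g 0    ≈⟨ +-cong (⊛-comm f (tail g) n) (*-comm _ _) ⟩
    (tail g ⊛ f) n + g 0 * f (suc n)    ≈⟨ +-comm _ _ ⟩
    (g ⊛ f) (suc n)                     ∎

  ⊛-assoc : ∀ f g h → ((f ⊛ g) ⊛ h) ≋ (f ⊛ (g ⊛ h))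
  ⊛-assoc f g h zero    = begin
    (f 0 * g 0 + 0#) * h 0 + 0# ≈⟨ +-congʳ (*-congʳ (+-identityʳ _)) ⟩
    f 0 * g 0 * h 0 + 0#        ≈⟨ +-congʳ (*-assoc _ _ _) ⟩
    f 0 * (g 0 * h 0) + 0#      ≈⟨ +-congʳ (*-congˡ (+-identityʳ _)) ⟨
    f 0 * (g 0 * h 0 + 0#) + 0# ∎
  ⊛-assoc f g h (suc n) = begin
    -- The tail of `f ⊛ g` computes to `(f 0 ⊙ tail g) ⊕ (tail f ⊛ g)`.
    (f 0 * g 0 + 0#) * h (suc n) + (((f 0 ⊙ tail g) ⊕ (tail f ⊛ g)) ⊛ h) n
      ≈⟨ +-cong (*-congʳ (+-identityʳ _)) (⊛-distribʳ h (f 0 ⊙ tail g) (tail f ⊛ g) n) ⟩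
    f 0 * g 0 * h (suc n) + (((f 0 ⊙ tail g) ⊛ h) n + ((tail f ⊛ g) ⊛ h) n)
      ≈⟨ +-cong (*-assoc _ _ _) (+-cong (⊙-⊛ (f 0) (tail g) h n) (⊛-assoc (tail f) g h n)) ⟩
    f 0 * (g 0 * h (suc n)) + (f 0 * (tail g ⊛ h) n + (tail f ⊛ (g ⊛ h)) n)
      ≈⟨ +-assoc _ _ _ ⟨
    (f 0 * (g 0 * h (suc n)) + f 0 * (tail g ⊛ h) n) + (tail f ⊛ (g ⊛ h)) n
      ≈⟨ +-congʳ (distribˡ _ _ _) ⟨
    f 0 * (g 0 * h (suc n) + (tail g ⊛ h) n) + (tail f ⊛ (g ⊛ h)) n ∎

  ⊕-⊛-isCommutativeRing : IsCommutativeRing _≋_ _⊕_ _⊛_ ⊝_ 𝟘 𝟙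
  ⊕-⊛-isCommutativeRing = record
    { isRing = record
      { +-isAbelianGroup = Pointwise.isAbelianGroup ℕ +-isAbelianGroup
      ; *-cong           = ⊛-cong
      ; *-assoc          = ⊛-assoc
      ; *-identity       = ⊛-identityˡ
                         , λ f n → trans (⊛-comm f 𝟙 n) (⊛-identityˡ f n)
      ; distrib          = (λ f g h n → trans (⊛-comm f (g ⊕ h) n)
                             (trans (⊛-distribʳ f g h n) (+-cong (⊛-comm g f n) (⊛-comm h f n))))
                         , ⊛-distribʳ
      }
    ; *-comm = ⊛-comm
    }

  commutativeRing : CommutativeRing c ℓ
  commutativeRing = record { isCommutativeRing = ⊕-⊛-isCommutativeRing }

  -- The lowest coefficient of the product forces `f 0` to vanish; then `g` also annihilates
  -- `tail f`, and the argument repeats.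
  f⊛g≋𝟘⇒f≋𝟘 : ∀ f g → (∀ a → a * g 0 ≈ 0# → a ≈ 0#) → (f ⊛ g) ≋ 𝟘 → f ≋ 𝟘
  f⊛g≋𝟘⇒f≋𝟘 f g cancel fg≋𝟘 = go f fg≋𝟘
    where
    go : ∀ f → (f ⊛ g) ≋ 𝟘 → f ≋ 𝟘
    f₀≈0 : ∀ f → (f ⊛ g) ≋ 𝟘 → f 0 ≈ 0#
    f₀≈0 f fg≋𝟘 = cancel (f 0) (trans (sym (+-identityʳ _)) (fg≋𝟘 0))
    go f fg≋𝟘 zero    = f₀≈0 f fg≋𝟘
    go f fg≋𝟘 (suc n) = go (tail f) tail-fg≋𝟘 n
      where
      tail-fg≋𝟘 : (tail f ⊛ g) ≋ 𝟘
      tail-fg≋𝟘 m = begin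
        (tail f ⊛ g) m                   ≈⟨ +-identityˡ _ ⟨
        0# + (tail f ⊛ g) m              ≈⟨ +-congʳ (zeroˡ _) ⟨
        0# * g (suc m) + (tail f ⊛ g) m  ≈⟨ +-congʳ (*-congʳ (f₀≈0 f fg≋𝟘)) ⟨
        (f ⊛ g) (suc m)                  ≈⟨ fg≋𝟘 (suc m) ⟩
        0#                               ∎

  -- Contraction in the x-adic sense: each application gains one coefficient of agreement, so
  -- iteration from `𝟘` converges.
  Contractive : (Series → Series) → Set _
  Contractive Φ = ∀ n {f g} → f ≈[ n ] g → Φ f ≈[ suc n ] Φ g

  module FixedPoint (Φ : Series → Series) (contractive : Contractive Φ) where

    approximant : ℕ → Series
    approximant zero    = 𝟘
    approximant (suc k) = Φ (approximant k)

    approximant-step : ∀ k → approximant k ≈[ k ] approximant (suc k)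
    approximant-step zero    m ()
    approximant-step (suc k) = contractive k (approximant-step k)

    -- Coefficient m is settled after m + 1 iterations. The order `_<′_` provides the induction
    -- upwards on k.
    approximant-stable : ∀ {m k} → m ℕ.<′ k → approximant (suc m) m ≈ approximant k m
    approximant-stable (ℕ.<′-base)   = refl
    approximant-stable (ℕ.<′-step {k} m<k) =
      trans (approximant-stable m<k) (approximant-step k _ (ℕ.<′⇒< m<k))

    fix : Series
    fix n = approximant (suc n) n

    fix-fixed : fix ≋ Φ fix
    -- `fix n` is by definition coefficient n of `Φ (approximant n)`, and `fix` agrees with
    -- `approximant n` below degree n.
    fix-fixed n = sym (contractive n (λ m m<n → approximant-stable (ℕ.<⇒<′ m<n)) n ℕ.≤-refl)

-- The polynomial ring ℤ[y].

module ℤ[y]-Properties where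

  open Polynomial
  open SeriesProperties ℤ.+-*-commutativeRing using (𝟙; _⊛_; ⊛-zeroˡ; ⊕-⊛-isCommutativeRing)

  coeff-+ : ∀ p q k → coeff (p + q) k ≡ coeff p k ℤ.+ coeff q k
  coeff-+ []      q       k       = ≡.sym (ℤ.+-identityˡ _)
  coeff-+ (a ∷ p) []      k       = ≡.sym (ℤ.+-identityʳ _)
  coeff-+ (a ∷ p) (b ∷ q) zero    = ≡.refl
  coeff-+ (a ∷ p) (b ∷ q) (suc k) = coeff-+ p q k

  coeff-map : ∀ f → f ℤ.0ℤ ≡ ℤ.0ℤ → ∀ p k → coeff (map f p) k ≡ f (coeff p k)
  coeff-map f f0≡0 []      k       = ≡.sym f0≡0
  coeff-map f f0≡0 (a ∷ p) zero    = ≡.refl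
  coeff-map f f0≡0 (a ∷ p) (suc k) = coeff-map f f0≡0 p k

  coeff-* : ∀ p q k → coeff (p * q) k ≡ (coeff p ⊛ coeff q) k
  coeff-* []      q k = ≡.sym (⊛-zeroˡ (coeff q) k)
  coeff-* (a ∷ p) q k = ≡.trans (coeff-+ (map (a ℤ.*_) q) (ℤ.0ℤ ∷ (p * q)) k)
    (≡.trans (≡.cong (ℤ._+ coeff (ℤ.0ℤ ∷ (p * q)) k) (coeff-map (a ℤ.*_) (ℤ.*-zeroʳ a) q k)) (step k))
    where
    step : ∀ k → a ℤ.* coeff q k ℤ.+ coeff (ℤ.0ℤ ∷ (p * q)) k ≡ (coeff (a ∷ p) ⊛ coeff q) k
    step zero    = ≡.refl
    step (suc k) = ≡.cong (ℤ._+_ (a ℤ.* coeff q (suc k))) (coeff-* p q k)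

  coeff-1 : ∀ k → coeff (ℤ.1ℤ ∷ []) k ≡ 𝟙 k
  coeff-1 zero    = ≡.refl
  coeff-1 (suc k) = ≡.refl

  -- Equality of polynomials is by definition equality of their images under `coeff` in the power
  -- series over ℤ, so the ring laws pull back along this embedding.
  isCommutativeRing : IsCommutativeRing _≈_ _+_ _*_ -_ [] (ℤ.1ℤ ∷ [])
  isCommutativeRing = RingMonomorphism.isCommutativeRing {R₁ = ℤ[y]} {⟦_⟧ = coeff} (record
    { isRingHomomorphism = record
      { isSemiringHomomorphism = record
        { isNearSemiringHomomorphism = record
          { +-isMonoidHomomorphism = record
            { isMagmaHomomorphism = record
              { isRelHomomorphism = record { cong = λ p≈q → p≈q }
              ; homo              = coeff-+
              }
            ; ε-homo = λ _ → ≡.refl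
            }
          ; *-homo = coeff-*
          }
        ; 1#-homo = coeff-1
        }
      ; -‿homo = coeff-map ℤ.-_ ≡.refl
      }
    ; injective = λ p≈q → p≈q
    }) ⊕-⊛-isCommutativeRing

  commutativeRing : CommutativeRing 0ℓ 0ℓ
  commutativeRing = record { isCommutativeRing = isCommutativeRing }

  2-torsion-free : ∀ p → (p + p) ≈ [] → p ≈ []
  2-torsion-free p p+p≈0 k = ℤ.*-cancelʳ-≡ (coeff p k) ℤ.0ℤ (ℤ.+ 2) (begin
    coeff p k ℤ.* ℤ.+ 2                        ≡⟨ ℤ.*-distribˡ-+ (coeff p k) ℤ.1ℤ ℤ.1ℤ ⟩
    coeff p k ℤ.* ℤ.1ℤ ℤ.+ coeff p k ℤ.* ℤ.1ℤ  ≡⟨ ≡.cong₂ ℤ._+_ (ℤ.*-identityʳ (coeff p k)) (ℤ.*-identityʳ (coeff p k)) ⟩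
    coeff p k ℤ.+ coeff p k                    ≡⟨ coeff-+ p p k ⟨
    coeff (p + p) k                            ≡⟨ p+p≈0 k ⟩
    ℤ.0ℤ                                       ∎)
    where open ≡.≡-Reasoning

-- Weighted enumeration of the avoiding words and its recursion.

module DescentWeights (R : CommutativeRing c ℓ) (y : CommutativeRing.Carrier R) where

  open CommutativeRing R
  open RawSemiringDefs (RawRing.rawSemiring rawRing) using (_^_)
  open FiniteSum rawRing using (∑)
  open SetoidReasoning setoid

  Forbidden : Word → Set
  Forbidden = Contains ℕ._<_ _≢_

  forbidden? : Decidable₁ Forbidden
  forbidden? = contains? _<?_ _≢?_

  -- Forbidden words stay in the lists with weight 0, so that sums run over all continuations and
  -- prepending letters acts by a scalar factor.
  weight : Word → Carrier
  weight w = if does (forbidden? w) then 0# else y ^ des w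

  total : List Word → Carrier
  total ws = foldr _+_ 0# (map weight ws)

  total-++ : ∀ vs ws → total (vs ++ ws) ≈ total vs + total ws
  total-++ []       ws = sym (+-identityˡ _)
  total-++ (v ∷ vs) ws = trans (+-congˡ (total-++ vs ws)) (sym (+-assoc (weight v) (total vs) (total ws)))

  total-map : ∀ a (f g : Word → Word) → (∀ w → weight (f w) ≈ a * weight (g w)) →
              ∀ ws → total (map f ws) ≈ a * total (map g ws)
  total-map a f g f≈ag []       = sym (zeroʳ a)
  total-map a f g f≈ag (w ∷ ws) = trans
    (+-cong (f≈ag w) (total-map a f g f≈ag ws))
    (sym (distribˡ a (weight (g w)) (total (map g ws))))

  total-upTo : ∀ (h : ℕ → List Word) n → total (concatMap h (upTo n)) ≈ ∑ (total ∘ h) n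
  total-upTo h zero    = refl
  total-upTo h (suc n) = begin
    total (concatMap h (upTo (suc n)))                       ≡⟨ ≡.cong (total ∘ concatMap h) (upTo-∷ʳ n) ⟨
    total (concatMap h (upTo n ++ [ n ]))                    ≡⟨ ≡.cong total (concatMap-++ h (upTo n) [ n ]) ⟩
    total (concatMap h (upTo n) ++ (h n ++ []))              ≡⟨ ≡.cong (λ ws → total (concatMap h (upTo n) ++ ws)) (++-identityʳ (h n)) ⟩
    total (concatMap h (upTo n) ++ h n)                      ≈⟨ total-++ (concatMap h (upTo n)) (h n) ⟩
    total (concatMap h (upTo n)) + total (h n)               ≈⟨ +-congʳ (total-upTo h n) ⟩
    ∑ (total ∘ h) n + total (h n)                            ∎

  total-filter : ∀ ws → foldr _+_ 0# (map (λ w → y ^ des w) (filter (avoids? _<?_ _≢?_) ws)) ≈ total ws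
  total-filter []       = refl
  total-filter (w ∷ ws) with does (forbidden? w)
  ... | true  = trans (total-filter ws) (sym (+-identityˡ (total ws)))
  ... | false = +-congˡ (total-filter ws)

  -- The rules for level steps and descents, and for a level step after an ascent, are instances:
  -- avoidance is unchanged and only the power of y moves.
  weight-scale : ∀ a v w → (Forbidden v ⇔ Forbidden w) → y ^ des v ≈ a * y ^ des w → weight v ≈ a * weight w
  weight-scale a v w v⇔w yᵛ≈ayʷ rewrite does-⇔ v⇔w (forbidden? v) (forbidden? w) with does (forbidden? w)
  ... | true  = sym (zeroʳ a)
  ... | false = yᵛ≈ayʷ

  weight-forbidden : ∀ {w} → Forbidden w → weight w ≈ 0#
  weight-forbidden {w} p rewrite dec-true (forbidden? w) p = refl

  forbidden-∷-≥ : ∀ {a b} → b ℕ.≤ a → ∀ v → Forbidden (a ∷ b ∷ v) ⇔ Forbidden (b ∷ v)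
  forbidden-∷-≥ b≤a v = mk⇔
    (λ { (here a<b _) → contradiction b≤a (ℕ.<⇒≱ a<b) ; (there p) → p })
    there

  des-∷-≤ : ∀ {a b} → a ℕ.≤ b → ∀ v → des (a ∷ b ∷ v) ≡ des (b ∷ v)
  des-∷-≤ {a} {b} a≤b v rewrite dec-false (b <? a) (ℕ.≤⇒≯ a≤b) = ≡.refl

  des-∷-> : ∀ {a b} → b ℕ.< a → ∀ v → des (a ∷ b ∷ v) ≡ suc (des (b ∷ v))
  des-∷-> {a} {b} b<a v rewrite dec-true (b <? a) b<a = ≡.refl

  y^-cong : ∀ {m n} → m ≡ n → y ^ m ≈ 1# * y ^ n
  y^-cong {m} ≡.refl = sym (*-identityˡ (y ^ m))

  weight-level : ∀ a v → weight (a ∷ a ∷ v) ≈ 1# * weight (a ∷ v)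
  weight-level a v = weight-scale 1# (a ∷ a ∷ v) (a ∷ v) (forbidden-∷-≥ ℕ.≤-refl v)
    (y^-cong (des-∷-≤ (ℕ.≤-refl {a}) v))

  weight-descent : ∀ {a b} → b ℕ.< a → ∀ v → weight (a ∷ b ∷ v) ≈ y * weight (b ∷ v)
  weight-descent {a} {b} b<a v = weight-scale y (a ∷ b ∷ v) (b ∷ v) (forbidden-∷-≥ (ℕ.<⇒≤ b<a) v)
    (reflexive (≡.cong (y ^_) (des-∷-> b<a v)))

  -- Neither new window is forbidden: the first ends in an equality, the second does not begin with
  -- an ascent.
  weight-ascent-level : ∀ a v → weight (a ∷ suc a ∷ suc a ∷ v) ≈ 1# * weight (suc a ∷ v)
  weight-ascent-level a v = weight-scale 1# (a ∷ suc a ∷ suc a ∷ v) (suc a ∷ v)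
    (mk⇔ (λ { (here _ b≢b) → contradiction ≡.refl b≢b
            ; (there (here b<b _)) → contradiction b<b (ℕ.<-irrefl ≡.refl)
            ; (there (there p)) → p })
         (there ∘ there))
    (y^-cong (≡.trans (des-∷-≤ (ℕ.n≤1+n a) (suc a ∷ v)) (des-∷-≤ (ℕ.≤-refl {suc a}) v)))

  -- The value 0 is written as a multiple of a weight so that `total-map-tails` applies with the
  -- factor `0#`.
  weight-ascent-≢ : ∀ {a b} → b ≢ suc a → ∀ v → weight (a ∷ suc a ∷ b ∷ v) ≈ 0# * weight (b ∷ v)
  weight-ascent-≢ {a} {b} b≢1+a v = begin
    weight (a ∷ suc a ∷ b ∷ v)  ≈⟨ weight-forbidden {a ∷ suc a ∷ b ∷ v} (here (ℕ.n<1+n a) (b≢1+a ∘ ≡.sym)) ⟩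
    0#                      ≈⟨ zeroˡ (weight (b ∷ v)) ⟨
    0# * weight (b ∷ v)         ∎

  -- The coefficient of x^n in G_a; the starting letter is not counted in n.
  startTotal : ℕ → ℕ → Carrier
  startTotal a n = total (map (a ∷_) (continuations a n))

  private
    tails : ℕ → ℕ → List Word
    tails n b = map (b ∷_) (continuations b n)

    total-map-tails : ∀ a (f : Word → Word) b n → (∀ v → weight (f (b ∷ v)) ≈ a * weight (b ∷ v)) →
                      total (map f (tails n b)) ≈ a * startTotal b n
    total-map-tails a f b n f≈ = begin
      total (map f (tails n b))                          ≡⟨ ≡.cong total (map-∘ (continuations b n)) ⟨
      total (map (f ∘ (b ∷_)) (continuations b n))       ≈⟨ total-map a (f ∘ (b ∷_)) (b ∷_) f≈ (continuations b n) ⟩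
      a * startTotal b n                                          ∎

    total-map-concatMap : ∀ (f : Word → Word) (h : ℕ → List Word) n →
      total (map f (concatMap h (upTo n))) ≈ ∑ (λ b → total (map f (h b))) n
    total-map-concatMap f h n = begin
      total (map f (concatMap h (upTo n)))   ≡⟨ ≡.cong total (map-concatMap f h (upTo n)) ⟩
      total (concatMap (map f ∘ h) (upTo n)) ≈⟨ total-upTo (map f ∘ h) n ⟩
      ∑ (λ b → total (map f (h b))) n        ∎

    ∑-scale : ∀ a (f g : ℕ → Carrier) n → (∀ b → b ℕ.< n → f b ≈ a * g b) → ∑ f n ≈ a * ∑ g n
    ∑-scale a f g zero    f≈ag = sym (zeroʳ a)
    ∑-scale a f g (suc n) f≈ag = begin
      ∑ f n + f n            ≈⟨ +-cong (∑-scale a f g n (λ b b<n → f≈ag b (ℕ.m<n⇒m<1+n b<n))) (f≈ag n ℕ.≤-refl) ⟩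
      a * ∑ g n + a * g n    ≈⟨ distribˡ a (∑ g n) (g n) ⟨
      a * (∑ g n + g n)      ∎

  afterAscent : ℕ → ℕ → Carrier
  afterAscent a n = total (map (a ∷_) (tails n (suc a)))

  startTotal-suc : ∀ a n → startTotal a (suc n) ≈
    (y * ∑ (λ b → startTotal b n) a + startTotal a n) + afterAscent a n
  startTotal-suc a n = begin
    startTotal a (suc n)
      -- The next letter b ranges over b < a (descent), b = a (level) and b = a + 1 (ascent).
      ≈⟨ total-map-concatMap (a ∷_) (tails n) (suc (suc a)) ⟩
    (∑ f a + f a) + afterAscent a n
      ≈⟨ +-congʳ (+-cong
           (∑-scale y f (λ b → startTotal b n) a (λ b b<a → total-map-tails y (a ∷_) b n (weight-descent b<a)))
           (trans (total-map-tails 1# (a ∷_) a n (weight-level a)) (*-identityˡ (startTotal a n)))) ⟩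
    (y * ∑ (λ b → startTotal b n) a + startTotal a n) + afterAscent a n ∎
    where
    f : ℕ → Carrier
    f b = total (map (a ∷_) (tails n b))

  afterAscent-zero : ∀ a → afterAscent a 0 ≈ 1#
  afterAscent-zero a = trans (+-identityʳ (weight (a ∷ suc a ∷ [])))
    (reflexive (≡.cong (y ^_) (des-∷-≤ (ℕ.n≤1+n a) [])))

  afterAscent-suc : ∀ a n → afterAscent a (suc n) ≈ startTotal (suc a) n
  afterAscent-suc a n = begin
    afterAscent a (suc n)
      ≡⟨ ≡.cong total (map-∘ (continuations (suc a) (suc n))) ⟨
    total (map f (continuations (suc a) (suc n)))
      -- After the ascent the next letter is at most a + 2. The sum splits into b ≤ a, b = a + 1 and
      -- b = a + 2, and only the middle one survives.
      ≈⟨ total-map-concatMap f (tails n) (suc (suc (suc a))) ⟩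
    (∑ g (suc a) + g (suc a)) + g (suc (suc a))
      ≈⟨ +-cong (+-cong
           (trans (∑-scale 0# g (λ b → startTotal b n) (suc a) (λ b b<1+a → excluded (ℕ.<⇒≢ b<1+a)))
                  (zeroˡ (∑ (λ b → startTotal b n) (suc a))))
           (trans (total-map-tails 1# f (suc a) n (weight-ascent-level a)) (*-identityˡ (startTotal (suc a) n))))
           (trans (excluded ℕ.1+n≢n) (zeroˡ (startTotal (suc (suc a)) n))) ⟩
    (0# + startTotal (suc a) n) + 0#
      ≈⟨ trans (+-identityʳ _) (+-identityˡ _) ⟩
    startTotal (suc a) n ∎
    where
    f : Word → Word
    f v = a ∷ suc a ∷ v

    g : ℕ → Carrier
    g b = total (map f (tails n b))

    excluded : ∀ {b} → b ≢ suc a → g b ≈ 0# * startTotal b n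
    excluded {b} b≢1+a = total-map-tails 0# f b n (weight-ascent-≢ b≢1+a)

  startTotal-zero : ∀ a → startTotal a 0 ≈ 1#
  startTotal-zero a = +-identityʳ 1#

  startTotal-one : ∀ a → startTotal a 1 ≈ (y * ∑ (λ b → startTotal b 0) a + startTotal a 0) + 1#
  startTotal-one a = trans (startTotal-suc a 0) (+-congˡ (afterAscent-zero a))

  -- An ascent that is not final forces a repeated letter, hence uses up two letters and reaches
  -- back two lengths.
  startTotal-suc-suc : ∀ a n → startTotal a (suc (suc n)) ≈
    (y * ∑ (λ b → startTotal b (suc n)) a + startTotal a (suc n)) + startTotal (suc a) n
  startTotal-suc-suc a n = trans (startTotal-suc a (suc n)) (+-congˡ (afterAscent-suc a n))

  -- Phrased so that over ℤ[y], with y the indeterminate, it computes to the series `C` of the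
  -- theorem.
  avoiders : ℕ → Carrier
  avoiders n = foldr _+_ 0# (map (λ w → y ^ des w) (filter (avoids? _<?_ _≢?_) (catalanWords n)))

-- Solving the recursion by power series.

module Solution (R : CommutativeRing c ℓ) (y : CommutativeRing.Carrier R) where

  open CommutativeRing R
  open DescentWeights R y
  open FiniteSum rawRing using (∑)
  open SeriesProperties R using (Series; _≋_; _⊕_; _⊛_; 𝟙; constant; constant-⊛;
    indeterminate-⊛-zero; indeterminate-⊛-suc; _≈[_]_; ⊛-cong-≤; Contractive; module FixedPoint)
  open SetoidReasoning setoid

  private
    module S = CommutativeRing (SeriesProperties.commutativeRing R)
    module ∑ˢ = FiniteSum S.rawRing

    open RawSemiringDefs (RawRing.rawSemiring S.rawRing) using (_^_) renaming (_×_ to _·_)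

    X Y : Series
    X = SeriesProperties.indeterminate R
    Y = constant y

  ∑-cong : ∀ {f g : ℕ → Carrier} → (∀ b → f b ≈ g b) → ∀ n → ∑ f n ≈ ∑ g n
  ∑-cong f≈g zero    = refl
  ∑-cong f≈g (suc n) = +-cong (∑-cong f≈g n) (f≈g n)

  ∑ˢ-coefficient : ∀ (F : ℕ → Series) a n → ∑ˢ.∑ F a n ≈ ∑ (λ b → F b n) a
  ∑ˢ-coefficient F zero    n = refl
  ∑ˢ-coefficient F (suc a) n = +-congʳ (∑ˢ-coefficient F a n)

  module _ (F : ℕ → Series)
    (F-rec : ∀ a → F a ≋ ((𝟙 ⊕ X) ⊕ (X ⊛ (((Y ⊛ ∑ˢ.∑ F a) ⊕ F a) ⊕ (X ⊛ F (suc a)))))) where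

    private
      stay : ℕ → ℕ → Carrier
      stay a n = y * ∑ (λ b → F b n) a + F a n

      stay-coefficient : ∀ a n → ((Y ⊛ ∑ˢ.∑ F a) ⊕ F a) n ≈ stay a n
      stay-coefficient a n = +-congʳ (trans (constant-⊛ y (∑ˢ.∑ F a) n) (*-congˡ (∑ˢ-coefficient F a n)))

      next : ℕ → Series
      next a = ((Y ⊛ ∑ˢ.∑ F a) ⊕ F a) ⊕ (X ⊛ F (suc a))

      F-zero : ∀ a → F a 0 ≈ 1#
      F-zero a = trans (F-rec a 0)
        (trans (+-cong (+-identityʳ 1#) (indeterminate-⊛-zero (next a))) (+-identityʳ 1#))

      F-one : ∀ a → F a 1 ≈ stay a 0 + 1#
      F-one a = begin
        F a 1
          ≈⟨ F-rec a 1 ⟩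
        (0# + 1#) + (X ⊛ next a) 1
          ≈⟨ +-cong (+-identityˡ 1#) (indeterminate-⊛-suc (next a) 0) ⟩
        1# + (((Y ⊛ ∑ˢ.∑ F a) ⊕ F a) 0 + (X ⊛ F (suc a)) 0)
          ≈⟨ +-congˡ (+-cong (stay-coefficient a 0) (indeterminate-⊛-zero (F (suc a)))) ⟩
        1# + (stay a 0 + 0#)
          ≈⟨ trans (+-congˡ (+-identityʳ _)) (+-comm _ _) ⟩
        stay a 0 + 1# ∎

      F-suc-suc : ∀ a n → F a (suc (suc n)) ≈ stay a (suc n) + F (suc a) n
      F-suc-suc a n = begin
        F a (suc (suc n))
          ≈⟨ F-rec a (suc (suc n)) ⟩
        (0# + 0#) + (X ⊛ next a) (suc (suc n))
          ≈⟨ +-cong (+-identityˡ 0#) (indeterminate-⊛-suc (next a) (suc n)) ⟩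
        0# + (((Y ⊛ ∑ˢ.∑ F a) ⊕ F a) (suc n) + (X ⊛ F (suc a)) (suc n))
          ≈⟨ +-identityˡ _ ⟩
        ((Y ⊛ ∑ˢ.∑ F a) ⊕ F a) (suc n) + (X ⊛ F (suc a)) (suc n)
          ≈⟨ +-cong (stay-coefficient a (suc n)) (indeterminate-⊛-suc (F (suc a)) n) ⟩
        stay a (suc n) + F (suc a) n ∎

    -- Induction on the length for all starting letters at once: coefficient n at a depends on
    -- shorter lengths only, but also on the letter a + 1.
    startTotal-unique : ∀ n a → startTotal a n ≈ F a n
    startTotal-unique zero          a = trans (startTotal-zero a) (sym (F-zero a))
    startTotal-unique (suc zero)    a = trans (startTotal-one a) (trans
      (+-congʳ (+-cong (*-congˡ (∑-cong (startTotal-unique 0) a)) (startTotal-unique 0 a)))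
      (sym (F-one a)))
    startTotal-unique (suc (suc n)) a = trans (startTotal-suc-suc a n) (trans
      (+-cong (+-cong (*-congˡ (∑-cong (startTotal-unique (suc n)) a)) (startTotal-unique (suc n) a))
              (startTotal-unique n (suc a)))
      (sym (F-suc-suc a n)))

  -- `Φ` is the right-hand side of the equation for u in the nested form of `u-root`; `Ψ` is the
  -- cofactor of its outermost x.
  Ψ Φ : Series → Series
  Ψ f = f ⊕ (X ⊛ (f ⊕ (X ⊛ (Y ⊛ (f ⊛ f)))))
  Φ f = 𝟙 ⊕ (X ⊛ Ψ f)

  -- The outer factor x shifts `Ψ f` by one degree, and `Ψ` preserves congruence modulo x^n.
  Φ-contractive : Contractive Φ
  Φ-contractive n {f} {g} f≈g zero    m<n       = +-congˡ
    (trans (indeterminate-⊛-zero (Ψ f)) (sym (indeterminate-⊛-zero (Ψ g))))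
  Φ-contractive n {f} {g} f≈g (suc m) (s≤s m<n) = +-congˡ (begin
    (X ⊛ Ψ f) (suc m)  ≈⟨ indeterminate-⊛-suc (Ψ f) m ⟩
    Ψ f m              ≈⟨ Ψ-cong m m<n ⟩
    Ψ g m              ≈⟨ indeterminate-⊛-suc (Ψ g) m ⟨
    (X ⊛ Ψ g) (suc m)  ∎)
    where
    _⟨⊕⟩_ : ∀ {f f′ g g′} → f ≈[ n ] f′ → g ≈[ n ] g′ → (f ⊕ g) ≈[ n ] (f′ ⊕ g′)
    (p ⟨⊕⟩ q) m m<n = +-cong (p m m<n) (q m m<n)

    _⟨⊛⟩_ : ∀ {f f′ g g′} → f ≈[ n ] f′ → g ≈[ n ] g′ → (f ⊛ g) ≈[ n ] (f′ ⊛ g′)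
    (p ⟨⊛⟩ q) m m<n = ⊛-cong-≤ m (λ i i≤m → p i (ℕ.<-≤-trans i≤m m<n)) (λ i i≤m → q i (ℕ.<-≤-trans i≤m m<n))

    same : ∀ f → f ≈[ n ] f
    same f _ _ = refl

    Ψ-cong : Ψ f ≈[ n ] Ψ g
    Ψ-cong = _⟨⊕⟩_ {f} {g} f≈g (_⟨⊛⟩_ {X} {X} (same X) (_⟨⊕⟩_ {f} {g} f≈g
      (_⟨⊛⟩_ {X} {X} (same X) (_⟨⊛⟩_ {Y} {Y} (same Y) (_⟨⊛⟩_ {f} {g} {f} {g} f≈g f≈g)))))

  open FixedPoint Φ Φ-contractive using (fix; fix-fixed)
  open RingProperties.ClosedForm (SeriesProperties.commutativeRing R) X Y fix fix-fixed public

  avoiders-formula : avoiders ≋ (𝟙 ⊕ (X ⊛ ((𝟙 ⊕ X) ⊛ fix)))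
  avoiders-formula zero    = +-congˡ (sym (indeterminate-⊛-zero ((𝟙 ⊕ X) ⊛ fix)))
  avoiders-formula (suc n) = begin
    avoiders (suc n)                    ≈⟨ total-filter (catalanWords (suc n)) ⟩
    -- A nonempty Catalan word starts with 0, so only a = 0 occurs, where λ^0 = 1.
    startTotal 0 n                      ≈⟨ startTotal-unique closedForm closedForm-recursion n 0 ⟩
    ((𝟙 ⊕ X) ⊛ (fix ⊛ 𝟙)) n             ≈⟨ S.*-congˡ {𝟙 ⊕ X} (S.*-identityʳ fix) n ⟩
    ((𝟙 ⊕ X) ⊛ fix) n                   ≈⟨ indeterminate-⊛-suc ((𝟙 ⊕ X) ⊛ fix) n ⟨
    (X ⊛ ((𝟙 ⊕ X) ⊛ fix)) (suc n)       ≈⟨ +-identityˡ _ ⟨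
    0# + (X ⊛ ((𝟙 ⊕ X) ⊛ fix)) (suc n)  ∎

  √D-constant-term : √D 0 ≈ 1#
  √D-constant-term = begin
    √D 0         ≈⟨ +-identityʳ _ ⟨
    √D 0 + 0#    ≈⟨ +-congˡ (trans (Q-multiple 0) (indeterminate-⊛-zero Q/x)) ⟨
    √D 0 + Q 0   ≈⟨ √D+Q≈1 0 ⟩
    1#           ∎

  -- From S² = T² follows (S - T)(S + T) = 0. The constant term of S + T is 2, which is cancellable
  -- in the absence of 2-torsion.
  sqrt-unique : (∀ a → a + a ≈ 0# → a ≈ 0#) → ∀ {S T} → S 0 ≈ 1# → T 0 ≈ 1# →
                (S ⊛ S) ≋ (T ⊛ T) → S ≋ T
  sqrt-unique 2-torsion-free {S} {T} S₀≈1 T₀≈1 S²≈T² = x∙y⁻¹≈ε⇒x≈y S T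
    (SeriesProperties.f⊛g≋𝟘⇒f≋𝟘 R (S S.- T) (S ⊕ T) cancel
      (RingProperties.difference-of-squares (SeriesProperties.commutativeRing R) {S} {T} S²≈T²))
    where
    open import Algebra.Properties.Group S.+-group using (x∙y⁻¹≈ε⇒x≈y)

    cancel : ∀ a → a * (S 0 + T 0) ≈ 0# → a ≈ 0#
    cancel a a*2≈0 = 2-torsion-free a (begin
      a + a               ≈⟨ +-cong (*-identityʳ a) (*-identityʳ a) ⟨
      a * 1# + a * 1#     ≈⟨ distribˡ a 1# 1# ⟨
      a * (1# + 1#)       ≈⟨ *-congˡ (+-cong S₀≈1 T₀≈1) ⟨
      a * (S 0 + T 0)     ≈⟨ a*2≈0 ⟩
      0#                  ∎)

  descent-formula : (∀ a → a + a ≈ 0# → a ≈ 0#) → ∀ S → S 0 ≈ 1# → (S ⊛ S) ≋ D →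
    (2 · X ^ 2 S.* Y S.* avoiders) ≋
    (𝟙 S.- 2 · X ^ 2 S.- X ^ 3 ⊕ 2 · X ^ 2 S.* Y S.- ((𝟙 ⊕ X) ⊛ S))
  descent-formula 2-torsion-free S S₀≈1 S²≈D = cleared-formula {avoiders} {S} avoiders-formula
    (sqrt-unique 2-torsion-free {S} {√D} S₀≈1 √D-constant-term
      (S.trans {S ⊛ S} {D} {√D ⊛ √D} S²≈D (S.sym {√D ⊛ √D} {D} √D²≈D)))

-- The generating function over ℤ[y].

open BivariateSeries

theorem3p36 : let D = 1# - 2 · x - x ^ 2 + 2 · x ^ 3 + x ^ 4 - 4 · x ^ 3 * y
    in (∃[ S ] IsSqrt D S)
    × (∀ S → IsSqrt D S →
    2 · x ^ 2 * y * C _<?_ _≢?_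
    ≈ 1# - 2 · x ^ 2 - x ^ 3 + 2 · x ^ 2 * y - (1# + x) * S)
theorem3p36 =
  (√D , √D-constant-term , √D²≈D) ,
  λ S (S₀≈1 , S²≈D) → descent-formula 2-torsion-free S S₀≈1 S²≈D
  where
  open ℤ[y]-Properties using (commutativeRing; 2-torsion-free)
  open Solution commutativeRing Polynomial.indeterminate
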